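{- Let $c,r$ be positive integers with $c<r<2c$, and let $n_1,\dots,n_c$ be positive integers. Then $R(B^rK_{n_1},\dots,B^rK_{n_c})\le \sum_{i=1}^c n_i$.
   Context: An $r$-uniform hypergraph ($r$-graph) consists of a vertex set and a set of $r$-element subsets of it (hyperedges); $\mathcal{K}_N^r$ denotes the complete $r$-graph on $N$ vertices and $K_m$ the complete graph on $m$ vertices. For a graph $F$, an $r$-graph $\mathcal{H}$ contains a Berge-$F$ if there are an injection $\varphi:V(F)\to V(\mathcal{H})$ and an injection $f$ from $E(F)$ to the hyperedges of $\mathcal{H}$ with $\{\varphi(x),\varphi(y)\}\subseteq f(xy)$ for every edge $xy$; $B^rF$ is the family of $r$-uniform Berge copies of $F$. A $c$-coloring assigns to each hyperedge one of the colors $1,\dots,c$. $R(B^rG_1,\dots,B^rG_c)$ is the smallest $N$ such that in every $c$-coloring of $\mathcal{K}_N^r$ there is an $i$ for which the hyperedges of color $i$ contain a Berge-$G_i$. -}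

module Defs where

open import Data.Nat using (ℕ; _<_; _≤_; _+_)
open import Data.Fin using (Fin) renaming (_<_ to _<ᶠ_)
open import Data.Fin.Subset using (Subset; _∈_; ∣_∣)
open import Data.List using (tabulate)
open import Data.Nat.ListAction using (sum)
open import Data.Product using (Σ; _×_; ∃)
open import Relation.Binary.PropositionalEquality using (_≡_)
open import Function.Definitions using (Injective)

IsHyperedge : (r N : ℕ) → Subset N → Set
IsHyperedge r N e = ∣ e ∣ ≡ r

-- A c-colouring of the hyperedges of K_N^r.  It is given as a function on
-- all subsets of Fin N; only its values on r-subsets are ever used.
Colouring : (c N : ℕ) → Set
Colouring c N = Subset N → Fin c

BergeClique : (r N c : ℕ) → Colouring c N → Fin c → ℕ → Set
BergeClique r N c χ i n =
  Σ (Fin n → Fin N) λ φ →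
  Σ (Fin n → Fin n → Subset N) λ f →
    Injective _≡_ _≡_ φ
    × (∀ x y → x <ᶠ y →
         IsHyperedge r N (f x y) × χ (f x y) ≡ i × φ x ∈ f x y × φ y ∈ f x y)
    × (∀ x y x' y' → x <ᶠ y → x' <ᶠ y' → f x y ≡ f x' y' → (x ≡ x' × y ≡ y'))

-- Every c-colouring of K_N^r contains, for some colour i, a Berge-K_{n i}
-- in colour i.  R(B^r K_{n_1},…,B^r K_{n_c}) ≤ N  iff this holds for N
-- (the property is monotone in N).
RamseyProperty : (r c : ℕ) → (Fin c → ℕ) → ℕ → Set
RamseyProperty r c n N =
  (χ : Colouring c N) → ∃ λ (i : Fin c) → BergeClique r N c χ i (n i)

sumFin : (c : ℕ) → (Fin c → ℕ) → ℕ
sumFin c n = sum (tabulate n)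

{-# OPTIONS --safe #-}
module Submission where

-- Write r = 1 + c + p and let the pad P consist of the first p vertices.  The
-- vertices v ≥ p are processed in increasing order while disjoint sets
-- U_1, …, U_c of earlier non-pad vertices are maintained.  For a transversal
-- t ∈ U_1 × … × U_c consider the hyperedge {v} ∪ {t_1, …, t_c} ∪ P.  There is a
-- colour i such that every u ∈ U_i is t_i for some transversal t whose
-- hyperedge has colour i: otherwise each U_j contains a bad u_j, and the
-- hyperedge of (u_1, …, u_c) has no possible colour.  Assign v to that U_i.
-- A hyperedge chosen for the pair vu has v as its largest vertex and meets the
-- old U_i only in u, so it determines the pair.  At the end the sizes of the
-- U_i add up to N - p > Σ (n_i - 1), since p < c.

open import Defs
open import Data.Nat using (ℕ; _<_; _≤_; _*_)
open import Data.Fin using (Fin)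
open import Data.Nat using (zero; suc; _+_; _∸_; z≤n; s≤s; _≤?_)
import Data.Nat.Properties as ℕ
open import Data.Fin using (zero; suc; toℕ; fromℕ<; inject≤) renaming (_<_ to _<ᶠ_)
import Data.Fin.Properties as Fin
open import Data.Fin.Subset using (Subset; _∈_; _∉_; ∣_∣; ⁅_⁆; _∪_; ⊥; inside; outside)
open import Data.Fin.Subset.Properties
  using (∪-identityˡ; x∈⁅x⁆; x∈⁅y⁆⇒x≡y; x∈p∪q⁻; x∈p∪q⁺; ∉⊥; ∣⊥∣≡0)
open import Data.List using (List; []; _∷_; length; lookup; _++_; tabulate)
open import Data.List.Properties using (length-++; length-tabulate)
open import Data.List.Membership.Propositional using () renaming (_∈_ to _∈ˡ_)
open import Data.List.Membership.Propositional.Properties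
  using (∈-++⁺ˡ; ∈-++⁻; ∈-tabulate⁺; ∈-tabulate⁻; ∈-lookup)
open import Data.List.Relation.Unary.Any using (here; there)
import Data.List.Relation.Unary.All as All
open import Data.List.Relation.Unary.AllPairs using ([]; _∷_)
open import Data.List.Relation.Unary.Unique.Propositional using (Unique)
import Data.List.Relation.Unary.Unique.Propositional.Properties as Unique
open import Data.Product using (_×_; _,_; ∃; proj₁; proj₂; map; map₂)
open import Data.Sum using (_⊎_; inj₁; inj₂; [_,_]′)
open import Data.Empty using () renaming (⊥ to Empty)
open import Data.Vec using (_∷_; here; there)
import Data.Vec.Functional as Vector
open import Function using (_∘_; id)
open import Function.Definitions using (Injective)
open import Relation.Binary.Definitions using (tri<; tri≈; tri>)
open import Relation.Binary.PropositionalEquality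
open import Relation.Nullary using (¬_; yes; no; contradiction)

-- Sizes of subsets listed without repetition

∣⁅x⁆∪p∣ : ∀ {n} (x : Fin n) (p : Subset n) → x ∉ p → ∣ ⁅ x ⁆ ∪ p ∣ ≡ suc ∣ p ∣
∣⁅x⁆∪p∣ zero    (inside  ∷ p) x∉p = contradiction here x∉p
∣⁅x⁆∪p∣ zero    (outside ∷ p) x∉p = cong (suc ∘ ∣_∣) (∪-identityˡ p)
∣⁅x⁆∪p∣ (suc x) (inside  ∷ p) x∉p = cong suc (∣⁅x⁆∪p∣ x p (x∉p ∘ there))
∣⁅x⁆∪p∣ (suc x) (outside ∷ p) x∉p = ∣⁅x⁆∪p∣ x p (x∉p ∘ there)

fromList : ∀ {n} → List (Fin n) → Subset n
fromList []       = ⊥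
fromList (x ∷ xs) = ⁅ x ⁆ ∪ fromList xs

∈-fromList⁺ : ∀ {n} {x : Fin n} {xs} → x ∈ˡ xs → x ∈ fromList xs
∈-fromList⁺ (here refl)  = x∈p∪q⁺ (inj₁ (x∈⁅x⁆ _))
∈-fromList⁺ (there x∈xs) = x∈p∪q⁺ (inj₂ (∈-fromList⁺ x∈xs))

∈-fromList⁻ : ∀ {n} {x : Fin n} xs → x ∈ fromList xs → x ∈ˡ xs
∈-fromList⁻ []       x∈ = contradiction x∈ ∉⊥
∈-fromList⁻ (y ∷ xs) x∈ with x∈p∪q⁻ ⁅ y ⁆ (fromList xs) x∈
... | inj₁ x∈⁅y⁆ = here (x∈⁅y⁆⇒x≡y y x∈⁅y⁆)
... | inj₂ x∈xs  = there (∈-fromList⁻ xs x∈xs)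

∣fromList∣ : ∀ {n} {xs : List (Fin n)} → Unique xs → ∣ fromList xs ∣ ≡ length xs
∣fromList∣ {n} [] = ∣⊥∣≡0 n
∣fromList∣ {xs = x ∷ xs} (x∉xs ∷ uniq) = trans
  (∣⁅x⁆∪p∣ x (fromList xs) λ x∈ → All.lookup x∉xs (∈-fromList⁻ xs x∈) refl)
  (cong suc (∣fromList∣ uniq))

-- Choosing one index that works for its whole class

all⊎ : ∀ {A R : Set} {P : A → Set} (xs : List A) →
       (∀ {x} → x ∈ˡ xs → R ⊎ P x) → R ⊎ (∀ {x} → x ∈ˡ xs → P x)
all⊎ []       h = inj₂ λ ()
all⊎ (x ∷ xs) h with h (here refl) | all⊎ xs (h ∘ there)
... | inj₁ r | _       = inj₁ r
... | inj₂ p | inj₁ r  = inj₁ r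
... | inj₂ p | inj₂ ps = inj₂ λ { (here refl) → p ; (there x∈xs) → ps x∈xs }

-- The alternative R serves the induction only: it records that the
-- coordinates fixed so far already succeed.
transversal⊎ : ∀ {A R : Set} c (U : Fin c → List A) (P : Fin c → A → Set) →
  (∀ (t : Fin c → A) → (∀ i → t i ∈ˡ U i) → R ⊎ ∃ λ i → P i (t i)) →
  R ⊎ ∃ λ i → ∀ {u} → u ∈ˡ U i → P i u
transversal⊎ zero U P h with h (λ ()) (λ ())
... | inj₁ r = inj₁ r
transversal⊎ {A} {R} (suc c) U P h = conclude (all⊎ (U zero) fix)
  where
  rest : Set
  rest = ∃ λ i → ∀ {u} → u ∈ˡ U (suc i) → P (suc i) u

  regroup : ∀ {u t} → R ⊎ (∃ λ i → P i ((u Vector.∷ t) i)) →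
            (R ⊎ P zero u) ⊎ ∃ λ i → P (suc i) (t i)
  regroup (inj₁ r)           = inj₁ (inj₁ r)
  regroup (inj₂ (zero , p))  = inj₁ (inj₂ p)
  regroup (inj₂ (suc i , p)) = inj₂ (i , p)

  -- With `u` as first coordinate, the recursion runs with the alternative enlarged to
  -- `R ⊎ P zero u`. A later index that works for its whole class settles the claim at once; if
  -- neither that nor `R` ever occurs, `P zero u` holds for every `u` in `U zero`.
  fix : ∀ {u} → u ∈ˡ U zero → (R ⊎ rest) ⊎ P zero u
  fix {u} u∈ with transversal⊎ c (U ∘ suc) (P ∘ suc) (λ t t∈ →
    regroup (h (u Vector.∷ t) λ { zero → u∈ ; (suc i) → t∈ i }))
  ... | inj₁ (inj₁ r) = inj₁ (inj₁ r)
  ... | inj₁ (inj₂ p) = inj₂ p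
  ... | inj₂ s        = inj₁ (inj₂ s)

  conclude : (R ⊎ rest) ⊎ (∀ {u} → u ∈ˡ U zero → P zero u) →
             R ⊎ ∃ λ i → ∀ {u} → u ∈ˡ U i → P i u
  conclude (inj₁ (inj₁ r))         = inj₁ r
  conclude (inj₁ (inj₂ (i , all))) = inj₂ (suc i , all)
  conclude (inj₂ all)              = inj₂ (zero , all)

-- `P` need not be decidable, since the index is found by searching the finite lists. An empty `U i`
-- qualifies vacuously, which is how a class can receive its first vertex.
transversal : ∀ {A : Set} c (U : Fin c → List A) (P : Fin c → A → Set) →
  (∀ (t : Fin c → A) → (∀ i → t i ∈ˡ U i) → ∃ λ i → P i (t i)) →
  ∃ λ i → ∀ {u} → u ∈ˡ U i → P i u
transversal c U P h with transversal⊎ {R = Empty} c U P (λ t t∈ → inj₂ (h t t∈))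
... | inj₂ res = res

-- Updated families and sums of sizes

updateAt⁺ : ∀ {A : Set} {c} (P : Fin c → A → Set) {f : A → A} (xs : Fin c → A) j →
  P j (f (xs j)) → (∀ i → P i (xs i)) → ∀ i → P i (Vector.updateAt xs j f i)
updateAt⁺ P xs zero    new old zero    = new
updateAt⁺ P xs zero    new old (suc i) = old (suc i)
updateAt⁺ P xs (suc j) new old zero    = old zero
updateAt⁺ P xs (suc j) new old (suc i) = updateAt⁺ (P ∘ suc) (xs ∘ suc) j new (old ∘ suc) i

-- If `f i < g i` held for every `i`, each index would use up one unit of the summand `c`, and the
-- sum of `g` would reach the right-hand side.
sumFin-pigeonhole : ∀ c (f g : Fin c → ℕ) → sumFin c g < c + sumFin c f → ∃ λ i → g i ≤ f i
sumFin-pigeonhole (suc c) f g lt with g zero ≤? f zero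
... | yes g≤f = zero , g≤f
... | no  g≰f = map suc id (sumFin-pigeonhole c (f ∘ suc) (g ∘ suc)
  (ℕ.+-cancelˡ-< (g zero) _ _ (ℕ.<-≤-trans lt (begin
    suc (c + (f zero + F)) ≡⟨ cong suc (trans (sym (ℕ.+-assoc c _ _)) (cong (_+ F) (ℕ.+-comm c _))) ⟩
    suc (f zero + c + F)   ≡⟨ cong suc (ℕ.+-assoc (f zero) c F) ⟩
    suc (f zero) + (c + F) ≤⟨ ℕ.+-monoˡ-≤ (c + F) (ℕ.≰⇒> g≰f) ⟩
    g zero + (c + F)       ∎))))
  where
  open ℕ.≤-Reasoning
  F : ℕ
  F = sumFin c (f ∘ suc)

sumFin-length-updateAt : ∀ {A : Set} c (U : Fin c → List A) j v →
  sumFin c (length ∘ Vector.updateAt U j (v ∷_)) ≡ suc (sumFin c (length ∘ U))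
sumFin-length-updateAt (suc c) U zero    v = refl
sumFin-length-updateAt (suc c) U (suc j) v = trans
  (cong (length (U zero) +_) (sumFin-length-updateAt c (U ∘ suc) j v))
  (ℕ.+-suc (length (U zero)) _)

sumFin-zero : ∀ c → sumFin c (λ _ → 0) ≡ 0
sumFin-zero zero    = refl
sumFin-zero (suc c) = sumFin-zero c

c≤sumFin : ∀ c (f : Fin c → ℕ) → (∀ i → 1 ≤ f i) → c ≤ sumFin c f
c≤sumFin zero    f 1≤f = z≤n
c≤sumFin (suc c) f 1≤f = ℕ.+-mono-≤ (1≤f zero) (c≤sumFin c (f ∘ suc) (1≤f ∘ suc))

-- A class may grow beyond the required clique size. Restriction is along an order-preserving map
-- because edges are constrained only for `x <ᶠ y`.
BergeClique-≤ : ∀ {r N c χ i m n} → m ≤ n → BergeClique r N c χ i n → BergeClique r N c χ i m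
BergeClique-≤ {m = m} {n} m≤n (φ , f , inj , edge , distinct) =
    φ ∘ ι , (λ x y → f (ι x) (ι y))
  , Fin.inject≤-injective m≤n m≤n _ _ ∘ inj
  , (λ x y → edge (ι x) (ι y) ∘ ι-mono)
  , λ x y x′ y′ x<y x′<y′ eq →
      map (Fin.inject≤-injective m≤n m≤n _ _) (Fin.inject≤-injective m≤n m≤n _ _)
        (distinct (ι x) (ι y) (ι x′) (ι y′) (ι-mono x<y) (ι-mono x′<y′) eq)
  where
  ι : Fin m → Fin n
  ι x = inject≤ x m≤n
  ι-mono : ∀ {x y} → x <ᶠ y → ι x <ᶠ ι y
  ι-mono {x} {y} = subst₂ _<_ (sym (Fin.toℕ-inject≤ x m≤n)) (sym (Fin.toℕ-inject≤ y m≤n))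

-- Towers of spokes and the Berge cliques they carry

module _ {c N : ℕ} (r : ℕ) (χ : Colouring c N) (i : Fin c) where

  -- Here `us` is the class before `v` joins it. From `edge` alone, `v-max` recovers `v`, and then
  -- `u-only` recovers `u`.
  record Spoke (us : List (Fin N)) (v u : Fin N) : Set where
    field
      edge   : Subset N
      size   : IsHyperedge r N edge
      colour : χ edge ≡ i
      v∈edge : v ∈ edge
      u∈edge : u ∈ edge
      v-max  : ∀ {w} → w ∈ edge → toℕ w ≤ toℕ v
      u-only : ∀ {w} → w ∈ˡ us → w ∈ edge → w ≡ u

  -- The most recently processed vertex is at the head.
  data Tower : List (Fin N) → Set where
    []   : Tower []
    cons : ∀ {v us} → (∀ {u} → u ∈ˡ us → u <ᶠ v) → (∀ {u} → u ∈ˡ us → Spoke us v u) →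
           Tower us → Tower (v ∷ us)

  open Spoke

  tower-desc : ∀ {us} → Tower us → ∀ {x y} → x <ᶠ y → lookup us y <ᶠ lookup us x
  tower-desc (cons us<v _ _) {zero}  {suc y} _         = us<v (∈-lookup y)
  tower-desc (cons _ _ tw)   {suc x} {suc y} (s≤s x<y) = tower-desc tw x<y

  tower-injective : ∀ {us} → Tower us → Injective _≡_ _≡_ (lookup us)
  tower-injective tw {x} {y} eq with Fin.<-cmp x y
  ... | tri< x<y _ _ = contradiction (sym eq) (Fin.<⇒≢ (tower-desc tw x<y))
  ... | tri≈ _ x≡y _ = x≡y
  ... | tri> _ _ y<x = contradiction eq (Fin.<⇒≢ (tower-desc tw y<x))

  tower-edge : ∀ {us} → Tower us → Fin (length us) → Fin (length us) → Subset N
  tower-edge (cons _ spoke _) zero    (suc y) = edge (spoke (∈-lookup y))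
  tower-edge (cons _ _ tw)    (suc x) (suc y) = tower-edge tw x y
  -- A dummy value: only pairs with `x <ᶠ y` are ever constrained.
  tower-edge _                _       _       = ⊥

  tower-edge-valid : ∀ {us} (tw : Tower us) x y → x <ᶠ y → let e = tower-edge tw x y in
    IsHyperedge r N e × χ e ≡ i × lookup us x ∈ e × lookup us y ∈ e
  tower-edge-valid (cons _ spoke _) zero (suc y) _ = size s , colour s , v∈edge s , u∈edge s
    where s = spoke (∈-lookup y)
  tower-edge-valid (cons _ _ tw) (suc x) (suc y) (s≤s x<y) = tower-edge-valid tw x y x<y

  tower-edge-max : ∀ {us} (tw : Tower us) x y → x <ᶠ y →
    ∀ {w} → w ∈ tower-edge tw x y → toℕ w ≤ toℕ (lookup us x)
  tower-edge-max (cons _ spoke _) zero    (suc y) _         = v-max (spoke (∈-lookup y))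
  tower-edge-max (cons _ _ tw)    (suc x) (suc y) (s≤s x<y) = tower-edge-max tw x y x<y

  -- The entries after position `x` are the class as it stood when the vertex at `x` was added, so
  -- `u-only` applies to every `z` beyond `x`.
  tower-edge-only : ∀ {us} (tw : Tower us) x y z → x <ᶠ y → x <ᶠ z →
    lookup us z ∈ tower-edge tw x y → lookup us z ≡ lookup us y
  tower-edge-only (cons _ spoke _) zero (suc y) (suc z) _ _ =
    u-only (spoke (∈-lookup y)) (∈-lookup z)
  tower-edge-only (cons _ _ tw) (suc x) (suc y) (suc z) (s≤s x<y) (s≤s x<z) =
    tower-edge-only tw x y z x<y x<z

  -- The vertex at `x` lies in its own edge, hence in the equal edge, whose largest vertex is the
  -- one at `x′`.
  tower-edge-top : ∀ {us} (tw : Tower us) x y x′ y′ → x <ᶠ y → x′ <ᶠ y′ →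
    tower-edge tw x y ≡ tower-edge tw x′ y′ → toℕ (lookup us x) ≤ toℕ (lookup us x′)
  tower-edge-top tw x y x′ y′ x<y x′<y′ eq = tower-edge-max tw x′ y′ x′<y′
    (subst (_ ∈_) eq (proj₁ (proj₂ (proj₂ (tower-edge-valid tw x y x<y)))))

  tower⇒BergeClique : ∀ {us} → Tower us → BergeClique r N c χ i (length us)
  tower⇒BergeClique {us} tw =
    lookup us , tower-edge tw , tower-injective tw , tower-edge-valid tw , distinct
    where
    distinct : ∀ x y x′ y′ → x <ᶠ y → x′ <ᶠ y′ →
               tower-edge tw x y ≡ tower-edge tw x′ y′ → x ≡ x′ × y ≡ y′
    -- Comparing tops in both directions gives `x ≡ x′`. Then `y` and `y′` both lie beyond the same
    -- position, and the shared edge meets the class there in a single vertex.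
    distinct x y x′ y′ x<y x′<y′ eq
      with tower-injective tw {x} {x′} (Fin.toℕ-injective (ℕ.≤-antisym
             (tower-edge-top tw x y x′ y′ x<y x′<y′ eq)
             (tower-edge-top tw x′ y′ x y x′<y′ x<y (sym eq))))
    ... | refl = refl , tower-injective tw (tower-edge-only tw x y′ y x′<y′ x<y
      (subst (_ ∈_) eq (proj₂ (proj₂ (proj₂ (tower-edge-valid tw x y x<y))))))

-- Distributing the vertices among the colour classes

module _ {c N p : ℕ} (p≤N : p ≤ N) (χ : Colouring c N) where

  -- The next vertex to process is `m`. The bounds and `disjoint` keep new vertex, transversal and
  -- pad apart, giving hyperedges of full size and the property `u-only`; `total` is kept for the
  -- final count.
  record State (m : ℕ) : Set where
    field
      U        : Fin c → List (Fin N)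
      lower    : ∀ i {u} → u ∈ˡ U i → p ≤ toℕ u
      upper    : ∀ i {u} → u ∈ˡ U i → toℕ u < m
      disjoint : ∀ i j {u} → u ∈ˡ U i → u ∈ˡ U j → i ≡ j
      tower    : ∀ i → Tower (suc (c + p)) χ i (U i)
      total    : sumFin c (length ∘ U) + p ≡ m

  pad : List (Fin N)
  pad = tabulate {n = p} λ k → inject≤ k p≤N

  pad< : ∀ {w} → w ∈ˡ pad → toℕ w < p
  pad< w∈ with ∈-tabulate⁻ w∈
  ... | k , refl = subst (_< p) (sym (Fin.toℕ-inject≤ k p≤N)) (Fin.toℕ<n k)

  init : State p
  init = record
    { U        = λ _ → []
    ; lower    = λ _ ()
    ; upper    = λ _ ()
    ; disjoint = λ _ _ ()
    ; tower    = λ _ → []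
    ; total    = cong (_+ p) (sumFin-zero c)
    }

  module _ {m : ℕ} (p≤m : p ≤ m) (m<N : m < N) (st : State m) where
    open State st

    v : Fin N
    v = fromℕ< m<N

    v≡m : toℕ v ≡ m
    v≡m = Fin.toℕ-fromℕ< m<N

    module _ (t : Fin c → Fin N) (t∈U : ∀ i → t i ∈ˡ U i) where

      below : List (Fin N)
      below = tabulate t ++ pad

      below< : ∀ {w} → w ∈ˡ below → w <ᶠ v
      below< w∈ rewrite v≡m with ∈-++⁻ (tabulate t) w∈
      ... | inj₂ w∈pad = ℕ.<-≤-trans (pad< w∈pad) p≤m
      ... | inj₁ w∈t with ∈-tabulate⁻ w∈t
      ...   | j , refl = upper j (t∈U j)

      below-unique : Unique below
      below-unique = Unique.++⁺
        (Unique.tabulate⁺ λ {i} {j} eq → disjoint i j (t∈U i) (subst (_∈ˡ U j) (sym eq) (t∈U j)))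
        (Unique.tabulate⁺ λ {i} {j} → Fin.inject≤-injective p≤N p≤N i j)
        λ { (w∈t , w∈pad) → case-t w∈pad (∈-tabulate⁻ w∈t) }
        where
        case-t : ∀ {w} → w ∈ˡ pad → ¬ (∃ λ j → w ≡ t j)
        case-t w∈pad (j , refl) = ℕ.<⇒≱ (pad< w∈pad) (lower j (t∈U j))

      hyperedge : Subset N
      hyperedge = fromList (v ∷ below)

      -- The colour is read off the hyperedge, and the coordinate of `t` in that colour becomes the
      -- far end of the spoke.
      transversal-spoke : let i = χ hyperedge in Spoke (suc (c + p)) χ i (U i) v (t i)
      transversal-spoke = record
        { edge   = hyperedge
        ; size   = trans (∣fromList∣ {xs = v ∷ below}
            (All.tabulate (λ w∈ eq → Fin.<⇒≢ (below< w∈) (sym eq)) ∷ below-unique))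
            (cong suc (trans (length-++ (tabulate t))
              (cong₂ _+_ (length-tabulate t) (length-tabulate {n = p} λ k → inject≤ k p≤N))))
        ; colour = refl
        ; v∈edge = ∈-fromList⁺ {xs = v ∷ below} (here refl)
        ; u∈edge = ∈-fromList⁺ {xs = v ∷ below} (there (∈-++⁺ˡ (∈-tabulate⁺ (χ hyperedge))))
        ; v-max  = λ w∈ → ≤v (∈-fromList⁻ (v ∷ below) w∈)
        ; u-only = λ w∈U w∈ → only w∈U (∈-fromList⁻ (v ∷ below) w∈)
        }
        where
        ≤v : ∀ {w} → w ∈ˡ v ∷ below → toℕ w ≤ toℕ v
        ≤v (here refl) = ℕ.≤-refl
        ≤v (there w∈)  = ℕ.<⇒≤ (below< w∈)

        -- The vertex `v` is too large to be in `U i`, pad vertices are too small, and `t j` can lie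
        -- in `U i` only when `j ≡ i`.
        only : ∀ {i w} → w ∈ˡ U i → w ∈ˡ v ∷ below → w ≡ t i
        only {i} w∈U (here refl) = contradiction v≡m (ℕ.<⇒≢ (upper i w∈U))
        only {i} w∈U (there w∈) with ∈-++⁻ (tabulate t) w∈
        ... | inj₂ w∈pad = contradiction (lower i w∈U) (ℕ.<⇒≱ (pad< w∈pad))
        ... | inj₁ w∈t with ∈-tabulate⁻ w∈t
        ...   | j , refl = cong t (disjoint j i (t∈U j) w∈U)

    step : State (suc m)
    -- The predicate is the spoke itself, so the chosen index `k` comes with every spoke needed to
    -- put `v` on top of its tower.
    step with transversal c U (λ i → Spoke (suc (c + p)) χ i (U i) v)
                (λ t t∈U → χ (hyperedge t t∈U) , transversal-spoke t t∈U)
    ... | k , spokes = record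
      { U        = U⁺
      ; lower    = λ i u∈ → [ (λ { (refl , _) → subst (p ≤_) (sym v≡m) p≤m }) , lower i ]′ (∈U⁺ i u∈)
      ; upper    = λ i u∈ → [ (λ { (refl , _) → ℕ.≤-reflexive (cong suc v≡m) })
                            , ℕ.m<n⇒m<1+n ∘ upper i ]′ (∈U⁺ i u∈)
      ; disjoint = λ i j u∈i u∈j → disjoint⁺ (∈U⁺ i u∈i) (∈U⁺ j u∈j)
      ; tower    = updateAt⁺ (Tower _ χ) U k
          (cons (λ u∈ → subst (_ <_) (sym v≡m) (upper k u∈)) spokes (tower k)) tower
      ; total    = trans (cong (_+ p) (sumFin-length-updateAt c U k v)) (cong suc total)
      }
      where
      U⁺ : Fin c → List (Fin N)
      U⁺ = Vector.updateAt U k (v ∷_)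

      ∈U⁺ : ∀ i {u} → u ∈ˡ U⁺ i → (u ≡ v × i ≡ k) ⊎ u ∈ˡ U i
      ∈U⁺ i {u} = updateAt⁺ (λ i us → u ∈ˡ us → (u ≡ v × i ≡ k) ⊎ u ∈ˡ U i) U k
        (λ { (here u≡v) → inj₁ (u≡v , refl) ; (there u∈) → inj₂ u∈ }) (λ _ → inj₂) i

      v∉U : ∀ i → ¬ (v ∈ˡ U i)
      v∉U i v∈ = ℕ.<⇒≢ (upper i v∈) v≡m

      disjoint⁺ : ∀ {i j u} → (u ≡ v × i ≡ k) ⊎ u ∈ˡ U i → (u ≡ v × j ≡ k) ⊎ u ∈ˡ U j → i ≡ j
      disjoint⁺ (inj₁ (_ , refl)) (inj₁ (_ , refl)) = refl
      disjoint⁺ (inj₁ (refl , _)) (inj₂ v∈)         = contradiction v∈ (v∉U _)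
      disjoint⁺ (inj₂ v∈)         (inj₁ (refl , _)) = contradiction v∈ (v∉U _)
      disjoint⁺ (inj₂ u∈i)        (inj₂ u∈j)        = disjoint _ _ u∈i u∈j

  run : ∀ d → d + p ≤ N → State (d + p)
  run zero    _  = init
  run (suc d) lt = step (ℕ.m≤n+m p d) lt (run d (ℕ.<⇒≤ lt))

-- The final count

theorem3 : (c r : ℕ) → 1 ≤ c → c < r → r < 2 * c →
    (n : Fin c → ℕ) → (∀ i → 1 ≤ n i) →
    RamseyProperty r c n (sumFin c n)
theorem3 c r _ c<r r<2c n 1≤n χ with ℕ.m≤n⇒∃[o]m+o≡n c<r
-- Here `p` is `r` minus `c + 1`, the room left beside `v` and the transversal.
... | p , refl = map₂ (λ {i} n≤ → BergeClique-≤ {χ = χ} n≤ (tower⇒BergeClique (suc (c + p)) χ i (tower i)))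
  (sumFin-pigeonhole c (length ∘ U) n (begin-strict
    sumFin c n                  ≡⟨ trans total d+p≡N ⟨
    sumFin c (length ∘ U) + p   <⟨ ℕ.+-monoʳ-< (sumFin c (length ∘ U)) p<c ⟩
    sumFin c (length ∘ U) + c   ≡⟨ ℕ.+-comm _ c ⟩
    c + sumFin c (length ∘ U)   ∎))
  where
  open ℕ.≤-Reasoning
  p<c : p < c
  -- This is the bound `r < 2 * c` with `r` written as `suc (c + p)`.
  p<c = ℕ.+-cancelˡ-< c p c (ℕ.<-trans (ℕ.n<1+n (c + p))
    (subst (suc (c + p) <_) (cong (c +_) (ℕ.+-identityʳ c)) r<2c))
  p≤N : p ≤ sumFin c n
  -- The pad fits among the vertices because every `n i` is at least 1, so their sum is at least
  -- `c`.
  p≤N = ℕ.≤-trans (ℕ.<⇒≤ p<c) (c≤sumFin c n 1≤n)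
  d+p≡N : sumFin c n ∸ p + p ≡ sumFin c n
  d+p≡N = ℕ.m∸n+n≡m p≤N
  open State (run p≤N χ (sumFin c n ∸ p) (ℕ.≤-reflexive d+p≡N))
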